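{- The languages $\mathcal{L}(\blacktriangle)$ and $\mathcal{L}(\Box)$ are equally expressive on the class of reflexive models ($\mathcal{T}$-models).
   Context: Let $\mathbf{P}$ be a set of propositional variables. $\mathcal{L}(\blacktriangle)$-formulas: $\varphi::=\top\mid p\mid\neg\varphi\mid(\varphi\land\varphi)\mid\blacktriangle\varphi$ with $p\in\mathbf{P}$. $\mathcal{L}(\Box)$-formulas: the same with $\Box\varphi$ in place of $\blacktriangle\varphi$. A model is $\mathcal{M}=\langle S,R,V\rangle$ with $S$ a nonempty set, $R\subseteq S\times S$, $V:\mathbf{P}\to\mathcal{P}(S)$; it is reflexive if $R$ is. A pointed model is a pair $(\mathcal{M},s)$ with $s\in S$. Truth: $\top$, variables, $\neg,\land$ as usual; $\mathcal{M},s\vDash\Box\varphi$ iff $\mathcal{M},t\vDash\varphi$ for all $t$ with $sRt$; $\mathcal{M},s\vDash\blacktriangle\varphi$ iff (if $\mathcal{M},s\vDash\varphi$ then $\mathcal{M},t\vDash\varphi$ for all $t$ with $sRt$) and (if $\mathcal{M},s\nvDash\varphi$ then $\mathcal{M},t\nvDash\varphi$ for all $t$ with $sRt$). Expressivity on a class $\mathbb{M}$ of models: $\mathcal{L}_1\preceq\mathcal{L}_2$ if for every $\varphi\in\mathcal{L}_1$ there is $\psi\in\mathcal{L}_2$ such that for every pointed model $(\mathcal{M},s)$ with $\mathcal{M}\in\mathbb{M}$, $\mathcal{M},s\vDash\varphi$ iff $\mathcal{M},s\vDash\psi$. $\mathcal{L}_1$ and $\mathcal{L}_2$ are equally expressive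 if $\mathcal{L}_1\preceq\mathcal{L}_2$ and $\mathcal{L}_2\preceq\mathcal{L}_1$. -}

module Defs where

open import Level using (Level; suc; _⊔_)
open import Data.Product using (_×_; ∃-syntax)
open import Data.Unit.Polymorphic using (⊤)
open import Function.Bundles using (_⇔_)
open import Relation.Binary.Core using (Rel)
open import Relation.Binary.Definitions using (Reflexive)
open import Relation.Nullary.Negation using (¬_)
open import Relation.Unary using (Pred)

private
  variable
    p ℓ m : Level

data Form▲ (P : Set p) : Set p where
  top  : Form▲ P
  var  : P → Form▲ P
  neg  : Form▲ P → Form▲ P
  conj : Form▲ P → Form▲ P → Form▲ P
  ▲_   : Form▲ P → Form▲ P

data Form□ (P : Set p) : Set p where
  top  : Form□ P
  var  : P → Form□ P
  neg  : Form□ P → Form□ P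
  conj : Form□ P → Form□ P → Form□ P
  □_   : Form□ P → Form□ P

record Model (P : Set p) (ℓ : Level) : Set (p ⊔ suc ℓ) where
  field
    S        : Set ℓ
    nonempty : S
    R        : Rel S ℓ
    V        : P → Pred S ℓ

open Model

ReflexiveModel : {P : Set p} → Pred (Model P ℓ) ℓ
ReflexiveModel M = Reflexive (R M)

infix 4 _,_⊨▲_ _,_⊨□_

_,_⊨▲_ : {P : Set p} (M : Model P ℓ) → S M → Form▲ P → Set ℓ
M , s ⊨▲ top      = ⊤
M , s ⊨▲ var q    = V M q s
M , s ⊨▲ neg φ    = ¬ (M , s ⊨▲ φ)
M , s ⊨▲ conj φ ψ = (M , s ⊨▲ φ) × (M , s ⊨▲ ψ)
M , s ⊨▲ (▲ φ)    =
    (M , s ⊨▲ φ → ∀ t → R M s t → M , t ⊨▲ φ)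
  × (¬ (M , s ⊨▲ φ) → ∀ t → R M s t → ¬ (M , t ⊨▲ φ))

_,_⊨□_ : {P : Set p} (M : Model P ℓ) → S M → Form□ P → Set ℓ
M , s ⊨□ top      = ⊤
M , s ⊨□ var q    = V M q s
M , s ⊨□ neg φ    = ¬ (M , s ⊨□ φ)
M , s ⊨□ conj φ ψ = (M , s ⊨□ φ) × (M , s ⊨□ ψ)
M , s ⊨□ (□ φ)    = ∀ t → R M s t → M , t ⊨□ φ

record Language (P : Set p) (ℓ : Level) : Set (suc (p ⊔ ℓ)) where
  field
    Formula : Set p
    _,_⊨_   : (M : Model P ℓ) → S M → Formula → Set ℓ

𝓛▲ : (P : Set p) (ℓ : Level) → Language P ℓ
𝓛▲ P ℓ = record { Formula = Form▲ P ; _,_⊨_ = _,_⊨▲_ }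

𝓛□ : (P : Set p) (ℓ : Level) → Language P ℓ
𝓛□ P ℓ = record { Formula = Form□ P ; _,_⊨_ = _,_⊨□_ }

_≼[_]_ : {P : Set p} → Language P ℓ → Pred (Model P ℓ) m → Language P ℓ →
         Set (p ⊔ suc ℓ ⊔ m)
L₁ ≼[ 𝕄 ] L₂ =
  (φ : L₁.Formula) → ∃[ ψ ] (∀ M → 𝕄 M → (s : S M) →
    (L₁._,_⊨_ M s φ) ⇔ (L₂._,_⊨_ M s ψ))
  where
  module L₁ = Language L₁
  module L₂ = Language L₂

EquallyExpressive : {P : Set p} → Pred (Model P ℓ) m → Language P ℓ →
                    Language P ℓ → Set (p ⊔ suc ℓ ⊔ m)
EquallyExpressive 𝕄 L₁ L₂ = (L₁ ≼[ 𝕄 ] L₂) × (L₂ ≼[ 𝕄 ] L₁)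

{-# OPTIONS --safe #-}
-- Over a reflexive frame, □φ amounts to ▲φ ∧ φ: reflexivity yields φ at the
-- current point, and φ together with ▲φ yields □φ.  Conversely, ▲φ is
-- (φ → □φ) ∧ (¬φ → □¬φ) over any frame; excluded middle serves only to write
-- → with ¬ and ∧.

module Submission where

open import Axiom.ExcludedMiddle using (ExcludedMiddle)
open import Data.Product using (_×_; _,_)
open import Data.Product.Function.NonDependent.Propositional using (_×-⇔_)
open import Function.Bundles using (_⇔_; mk⇔; Equivalence)
open import Function.Properties.Equivalence using (⇔-isEquivalence)
open import Function.Related.TypeIsomorphisms using (→-cong-⇔; ¬-cong-⇔)
open import Level using (Level)
open import Relation.Binary.Definitions using (Reflexive)
open import Relation.Binary.Structures using (IsEquivalence)
open import Relation.Nullary.Decidable using (decidable-stable)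
open import Relation.Nullary.Negation using (¬_)
open import Defs

private
  variable
    p ℓ : Level
    P : Set p

open Equivalence using (to; from)
open Model

⇔-refl : {A : Set ℓ} → A ⇔ A
⇔-refl = IsEquivalence.refl ⇔-isEquivalence

⇔-trans : {A B C : Set ℓ} → A ⇔ B → B ⇔ C → A ⇔ C
⇔-trans = IsEquivalence.trans ⇔-isEquivalence

-- Stated for arbitrary predicates on points, so that it serves both translations, and `¬φ` as well
-- as `φ`.
∀-successor-cong-⇔ : (M : Model P ℓ) {A B : S M → Set ℓ} →
  (∀ t → A t ⇔ B t) → (s : S M) →
  (∀ t → R M s t → A t) ⇔ (∀ t → R M s t → B t)
∀-successor-cong-⇔ M A⇔B s =
  mk⇔ (λ f t r → to (A⇔B t) (f t r)) (λ f t r → from (A⇔B t) (f t r))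

-- The forward direction is constructive; the converse only yields `¬ ¬ B`, from which excluded
-- middle recovers `B`.
→⇔¬×¬ : ExcludedMiddle ℓ → {A B : Set ℓ} → (A → B) ⇔ (¬ (A × ¬ B))
→⇔¬×¬ em = mk⇔
  (λ f (a , ¬b) → ¬b (f a))
  (λ h a → decidable-stable em (λ ¬b → h (a , ¬b)))

infixr 5 _⇒□_

_⇒□_ : Form□ P → Form□ P → Form□ P
φ ⇒□ ψ = neg (conj φ (neg ψ))

▲⇒□ : Form▲ P → Form□ P
▲⇒□ top        = top
▲⇒□ (var q)    = var q
▲⇒□ (neg φ)    = neg (▲⇒□ φ)
▲⇒□ (conj φ ψ) = conj (▲⇒□ φ) (▲⇒□ ψ)
▲⇒□ (▲ φ)      =
  conj (▲⇒□ φ ⇒□ □ ▲⇒□ φ) (neg (▲⇒□ φ) ⇒□ □ neg (▲⇒□ φ))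

□⇒▲ : Form□ P → Form▲ P
□⇒▲ top        = top
□⇒▲ (var q)    = var q
□⇒▲ (neg φ)    = neg (□⇒▲ φ)
□⇒▲ (conj φ ψ) = conj (□⇒▲ φ) (□⇒▲ ψ)
□⇒▲ (□ φ)      = conj (▲ □⇒▲ φ) (□⇒▲ φ)

▲⇒□-correct : ExcludedMiddle ℓ → (φ : Form▲ P) (M : Model P ℓ) (s : S M) →
  (M , s ⊨▲ φ) ⇔ (M , s ⊨□ ▲⇒□ φ)
▲⇒□-correct em top        M s = ⇔-refl
▲⇒□-correct em (var q)    M s = ⇔-refl
▲⇒□-correct em (neg φ)    M s = ¬-cong-⇔ (▲⇒□-correct em φ M s)
▲⇒□-correct em (conj φ ψ) M s =
  ▲⇒□-correct em φ M s ×-⇔ ▲⇒□-correct em ψ M s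
▲⇒□-correct em (▲ φ)      M s =
  -- Each half of the truth condition of `▲` is an implication from `s` to its successors: first
  -- translate premise and conclusion, then pass to the form that `⇒□` denotes.
  ⇔-trans (→-cong-⇔ (ih s) (∀-successor-cong-⇔ M ih s)) (→⇔¬×¬ em)
  ×-⇔
  ⇔-trans (→-cong-⇔ (¬ih s) (∀-successor-cong-⇔ M ¬ih s)) (→⇔¬×¬ em)
  where
  -- The point stays free: the hypothesis is needed at `s` and at every successor.
  ih  = ▲⇒□-correct em φ M
  ¬ih = λ t → ¬-cong-⇔ (ih t)

-- The left side spells out the truth condition of `□`, because `φ` lies in the language without
-- `□`.
⊨▲-conj-▲ : (φ : Form▲ P) (M : Model P ℓ) → Reflexive (R M) → (s : S M) →
  (∀ t → R M s t → M , t ⊨▲ φ) ⇔ (M , s ⊨▲ conj (▲ φ) φ)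
⊨▲-conj-▲ φ M refl s = mk⇔
  -- Reflexivity puts `s` among its own successors, so `φ` holds there and the premise `¬φ` of the
  -- second half of `▲` is absurd.
  (λ □φ → ((λ _ → □φ) , (λ ¬φ t r _ → ¬φ (□φ s refl))) , □φ s refl)
  (λ ((φ→□φ , _) , φs) → φ→□φ φs)

□⇒▲-correct : (φ : Form□ P) (M : Model P ℓ) → Reflexive (R M) → (s : S M) →
  (M , s ⊨□ φ) ⇔ (M , s ⊨▲ □⇒▲ φ)
□⇒▲-correct top        M refl s = ⇔-refl
□⇒▲-correct (var q)    M refl s = ⇔-refl
□⇒▲-correct (neg φ)    M refl s = ¬-cong-⇔ (□⇒▲-correct φ M refl s)
□⇒▲-correct (conj φ ψ) M refl s =
  □⇒▲-correct φ M refl s ×-⇔ □⇒▲-correct ψ M refl s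
□⇒▲-correct (□ φ)      M refl s =
  ⇔-trans (∀-successor-cong-⇔ M (□⇒▲-correct φ M refl) s)
          (⊨▲-conj-▲ (□⇒▲ φ) M refl s)

proposition12 : ∀ {p ℓ} → ExcludedMiddle ℓ → (P : Set p) →
    EquallyExpressive {ℓ = ℓ} ReflexiveModel (𝓛▲ P ℓ) (𝓛□ P ℓ)
proposition12 em P =
  (λ φ → ▲⇒□ φ , λ M _ → ▲⇒□-correct em φ M) ,
  (λ φ → □⇒▲ φ , □⇒▲-correct φ)
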